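{- The statement $OTT(\mathrm{cov}K)$ is false.
   Context: $\mathrm{cov}K$ is the least cardinal $\kappa$ such that the real line can be covered by $\kappa$ many nowhere dense sets. For a cardinal $\kappa$, $OTT(\kappa)$ is the following statement: for every finite $n>2$, every countable consistent theory $T$ in $L_n$ (first order logic restricted to the first $n$ variables) whose Tarski–Lindenbaum algebra $\mathfrak{Fm}_T$ belongs to $\mathfrak{Nr}_n\mathsf{CA}_\omega$, and every family of $\kappa$ many non-principal types of $T$, there is a model of $T$ omitting all types in the family. Here a type $\Gamma$ (a set of $L_n$ formulas) is non-principal if there is no formula $\psi$ consistent with $T$ with $T\models\psi\to\phi$ for all $\phi\in\Gamma$; a model $\mathfrak M$ omits $\Gamma$ if no assignment $s\in{}^nM$ satisfies all formulas in $\Gamma$. $\mathsf{CA}_\omega$ is the class of cylindric algebras of dimension $\omega$, and $\mathfrak{Nr}_n\mathsf{CA}_\omega$ is the class of (isomorphic copies of) neat $n$-reducts $\mathfrak{Nr}_n\mathfrak B$, $\mathfrak B\in\mathsf{CA}_\omega$, where $\mathfrak{Nr}_n\mathfrak B$ has universe $\{b:c_ib=b\text{ for all }i\ge n\}$ and the operations of $\mathfrak B$ with indices $<n$. -}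

module Defs where

open import Algebra.Lattice.Bundles using (BooleanAlgebra)
open import Algebra.Lattice.Structures using (IsBooleanAlgebra)
import Algebra.Lattice.Properties.BooleanAlgebra as BooleanAlgebraProperties
open import Data.Empty using (⊥)
open import Data.Fin.Base using (Fin; toℕ)
open import Data.Fin.Properties using (toℕ<n)
open import Data.Nat.Base as ℕ using (ℕ)
open import Data.Nat.Properties using (<⇒≢; <-≤-trans)
open import Data.Product.Base using (Σ-syntax; ∃-syntax; _×_; _,_; proj₁; proj₂)
open import Data.Rational.Base as ℚ using (ℚ; 0ℚ)
open import Data.Sum.Base using (_⊎_)
open import Data.Unit.Base using (⊤)
open import Data.Vec.Base using (Vec; lookup; map; _[_]≔_)
import Data.Vec.Membership.Propositional as Vec
open import Function.Bundles using (_↣_)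
open import Function.Definitions using (Congruent; Bijective)
open import Level using (Level; 0ℓ; _⊔_) renaming (suc to lsuc)
open import Relation.Binary.Definitions using (_Respects_)
open import Relation.Binary.PropositionalEquality using (_≡_; _≢_; ≢-sym)
import Relation.Binary.Reasoning.Setoid as SetoidReasoning
open import Relation.Nullary.Negation using (¬_)
open import Relation.Unary using (Pred; _∈_; _⊆_; Empty; Satisfiable; _∩_)

-- ℝ is the setoid of Cauchy sequences of rationals under _≃_.

record ℝ : Set where
  field
    seq    : ℕ → ℚ
    cauchy : ∀ ε → 0ℚ ℚ.< ε →
             ∃[ N ] (∀ m n → N ℕ.≤ m → N ℕ.≤ n → ℚ.∣ seq m ℚ.- seq n ∣ ℚ.< ε)

-- y ∈ Ball x ε says that the real number ∣ x - y ∣ is less than ε.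

Ball : ℝ → ℚ → Pred ℝ 0ℓ
Ball x ε y = ∃[ δ ] (δ ℚ.< ε ×
  (∃[ N ] (∀ m → N ℕ.≤ m → ℚ.∣ ℝ.seq x m ℚ.- ℝ.seq y m ∣ ℚ.≤ δ)))

infix 4 _≃_

_≃_ : ℝ → ℝ → Set
x ≃ y = ∀ ε → 0ℚ ℚ.< ε → y ∈ Ball x ε

Closure : Pred ℝ 0ℓ → Pred ℝ 0ℓ
Closure A x = ∀ ε → 0ℚ ℚ.< ε → Satisfiable (Ball x ε ∩ A)

Interior : Pred ℝ 0ℓ → Pred ℝ 0ℓ
Interior A x = ∃[ ε ] (0ℚ ℚ.< ε × Ball x ε ⊆ A)

NowhereDense : Pred ℝ 0ℓ → Set
NowhereDense A = Empty (Interior (Closure A))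

-- The predicates are required to respect _≃_, so that they are subsets of
-- the real line rather than sets of Cauchy sequences.

NowhereDenseCover : Set → Set₁
NowhereDenseCover K = Σ[ A ∈ (K → Pred ℝ 0ℓ) ]
  ((∀ k → (A k) Respects _≃_) ×
   (∀ k → NowhereDense (A k)) ×
   (∀ x → ∃[ k ] x ∈ A k))

-- Cardinals are represented by types, compared by injections: K has
-- cardinality cov K when it indexes a cover and injects into every other
-- type that does.

IsCovK : Set → Set₁
IsCovK K = NowhereDenseCover K × (∀ (J : Set) → NowhereDenseCover J → K ↣ J)

record RawCylindricAlgebra (I : Set) (a ℓ : Level) : Set (lsuc (a ⊔ ℓ)) where
  infix  8 -_
  infixr 7 _·_
  infixr 6 _+_
  infix  4 _≈_
  field
    Carrier : Set a
    _≈_     : Carrier → Carrier → Set ℓ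
    _+_ _·_ : Carrier → Carrier → Carrier
    -_      : Carrier → Carrier
    𝟏 𝟎     : Carrier
    c       : I → Carrier → Carrier
    d       : I → I → Carrier

record IsCylindricAlgebra {I : Set} {a ℓ : Level}
                          (A : RawCylindricAlgebra I a ℓ) : Set (a ⊔ ℓ) where
  open RawCylindricAlgebra A
  field
    isBooleanAlgebra : IsBooleanAlgebra _≈_ _+_ _·_ -_ 𝟏 𝟎
    c-cong : ∀ i {x y} → x ≈ y → c i x ≈ c i y
    c-zero : ∀ i → c i 𝟎 ≈ 𝟎
    c-incr : ∀ i x → x · c i x ≈ x
    c-meet : ∀ i x y → c i (x · c i y) ≈ c i x · c i y
    c-comm : ∀ i j x → c i (c j x) ≈ c j (c i x)
    d-refl : ∀ i → d i i ≈ 𝟏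
    d-comp : ∀ i j k → k ≢ i → k ≢ j → d i j ≈ c k (d i k · d k j)
    d-func : ∀ i j x → i ≢ j → c i (d i j · x) · c i (d i j · - x) ≈ 𝟎

record CylindricAlgebra (I : Set) (a ℓ : Level) : Set (lsuc (a ⊔ ℓ)) where
  field
    raw                : RawCylindricAlgebra I a ℓ
    isCylindricAlgebra : IsCylindricAlgebra raw
  open RawCylindricAlgebra raw public
  open IsCylindricAlgebra isCylindricAlgebra public

record _≅_ {I : Set} {a ℓ a′ ℓ′ : Level} (A : RawCylindricAlgebra I a ℓ)
           (B : RawCylindricAlgebra I a′ ℓ′) : Set (a ⊔ ℓ ⊔ a′ ⊔ ℓ′) where
  private
    module A = RawCylindricAlgebra A
    module B = RawCylindricAlgebra B
  field
    to        : A.Carrier → B.Carrier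
    cong      : Congruent A._≈_ B._≈_ to
    bijective : Bijective A._≈_ B._≈_ to
    +-homo    : ∀ x y → to (x A.+ y) B.≈ to x B.+ to y
    ·-homo    : ∀ x y → to (x A.· y) B.≈ to x B.· to y
    neg-homo  : ∀ x → to (A.- x) B.≈ B.- to x
    𝟏-homo    : to A.𝟏 B.≈ B.𝟏
    𝟎-homo    : to A.𝟎 B.≈ B.𝟎
    c-homo    : ∀ i x → to (A.c i x) B.≈ B.c i (to x)
    d-homo    : ∀ i j → to (A.d i j) B.≈ B.d i j

module _ {I : Set} {a ℓ : Level} (B : CylindricAlgebra I a ℓ) where
  open CylindricAlgebra B

  private
    booleanAlgebra : BooleanAlgebra a ℓ
    booleanAlgebra = record { isBooleanAlgebra = isBooleanAlgebra }

    open BooleanAlgebra booleanAlgebra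
      using (setoid; refl; sym; trans; ∨-cong; ∧-cong; ∧-comm; ¬-cong;
             ∨-comm; ∧-distribˡ-∨; ∨-complementʳ; ∧-complementˡ)
    open BooleanAlgebraProperties booleanAlgebra
      using (∧-identityʳ; ∧-identityˡ; ∨-identityʳ; ¬-involutive; deMorgan₂)
    open SetoidReasoning setoid

  Closed : I → Carrier → Set ℓ
  Closed i x = c i x ≈ x

  𝟎-closed : ∀ i → Closed i 𝟎
  𝟎-closed = c-zero

  𝟏-closed : ∀ i → Closed i 𝟏
  𝟏-closed i = trans (sym (∧-identityˡ (c i 𝟏))) (c-incr i 𝟏)

  ·-closed : ∀ i {x y} → Closed i x → Closed i y → Closed i (x · y)
  ·-closed i {x} {y} cx cy = begin
    c i (x · y)      ≈⟨ c-cong i (∧-cong refl cy) ⟨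
    c i (x · c i y)  ≈⟨ c-meet i x y ⟩
    c i x · c i y    ≈⟨ ∧-cong cx cy ⟩
    x · y            ∎

  neg-closed : ∀ i {x} → Closed i x → Closed i (- x)
  neg-closed i {x} cx = begin
    c i (- x)                            ≈⟨ ∧-identityʳ _ ⟨
    c i (- x) · 𝟏                        ≈⟨ ∧-cong refl (∨-complementʳ x) ⟨
    c i (- x) · (x + - x)                ≈⟨ ∧-distribˡ-∨ _ x (- x) ⟩
    c i (- x) · x + c i (- x) · - x      ≈⟨ ∨-cong disjoint below ⟩
    𝟎 + - x                              ≈⟨ ∨-comm 𝟎 (- x) ⟩
    - x + 𝟎                              ≈⟨ ∨-identityʳ (- x) ⟩
    - x                                  ∎
    where
    disjoint : c i (- x) · x ≈ 𝟎
    disjoint = begin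
      c i (- x) · x      ≈⟨ ∧-cong refl cx ⟨
      c i (- x) · c i x  ≈⟨ c-meet i (- x) x ⟨
      c i (- x · c i x)  ≈⟨ c-cong i (∧-cong refl cx) ⟩
      c i (- x · x)      ≈⟨ c-cong i (∧-complementˡ x) ⟩
      c i 𝟎              ≈⟨ c-zero i ⟩
      𝟎                  ∎

    below : c i (- x) · - x ≈ - x
    below = trans (∧-comm _ _) (c-incr i (- x))

  +-closed : ∀ i {x y} → Closed i x → Closed i y → Closed i (x + y)
  +-closed i {x} {y} cx cy = begin
    c i (x + y)            ≈⟨ c-cong i sum ⟩
    c i (- (- x · - y))    ≈⟨ neg-closed i (·-closed i (neg-closed i cx) (neg-closed i cy)) ⟩
    - (- x · - y)          ≈⟨ sum ⟨
    x + y                  ∎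
    where
    sum : x + y ≈ - (- x · - y)
    sum = trans (sym (¬-involutive (x + y))) (¬-cong (deMorgan₂ x y))

  cc-closed : ∀ i x → Closed i (c i x)
  cc-closed i x = begin
    c i (c i x)      ≈⟨ c-cong i (∧-identityˡ (c i x)) ⟨
    c i (𝟏 · c i x)  ≈⟨ c-meet i 𝟏 x ⟩
    c i 𝟏 · c i x    ≈⟨ ∧-cong (𝟏-closed i) refl ⟩
    𝟏 · c i x        ≈⟨ ∧-identityˡ (c i x) ⟩
    c i x            ∎

  c-closed : ∀ i j {x} → Closed i x → Closed i (c j x)
  c-closed i j {x} cx = trans (c-comm i j x) (c-cong j cx)

  d-closed : ∀ i j k → i ≢ j → i ≢ k → Closed i (d j k)
  d-closed i j k i≢j i≢k = begin
    c i (d j k)                    ≈⟨ c-cong i (d-comp j k i i≢j i≢k) ⟩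
    c i (c i (d j i · d i k))      ≈⟨ cc-closed i _ ⟩
    c i (d j i · d i k)            ≈⟨ d-comp j k i i≢j i≢k ⟨
    d j k                          ∎

𝔑𝔯 : ∀ (n : ℕ) {a ℓ} → CylindricAlgebra ℕ a ℓ → RawCylindricAlgebra (Fin n) (a ⊔ ℓ) ℓ
𝔑𝔯 n B = record
  { Carrier = Σ[ b ∈ Carrier ] (∀ i → n ℕ.≤ i → c i b ≈ b)
  ; _≈_     = λ x y → proj₁ x ≈ proj₁ y
  ; _+_     = λ x y → proj₁ x + proj₁ y , λ i n≤i → +-closed B i (proj₂ x i n≤i) (proj₂ y i n≤i)
  ; _·_     = λ x y → proj₁ x · proj₁ y , λ i n≤i → ·-closed B i (proj₂ x i n≤i) (proj₂ y i n≤i)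
  ; -_      = λ x → - proj₁ x , λ i n≤i → neg-closed B i (proj₂ x i n≤i)
  ; 𝟏       = 𝟏 , λ i _ → 𝟏-closed B i
  ; 𝟎       = 𝟎 , λ i _ → 𝟎-closed B i
  ; c       = λ j x → c (toℕ j) (proj₁ x) , λ i n≤i → c-closed B i (toℕ j) (proj₂ x i n≤i)
  ; d       = λ j k → d (toℕ j) (toℕ k) ,
                      λ i n≤i → d-closed B i (toℕ j) (toℕ k) (outside j n≤i) (outside k n≤i)
  }
  where
  open CylindricAlgebra B
  outside : ∀ {i} (j : Fin n) → n ℕ.≤ i → i ≢ toℕ j
  outside j n≤i = ≢-sym (<⇒≢ (<-≤-trans (toℕ<n j) n≤i))

-- The universe levels are those of the algebra 𝔉𝔪 below.  A larger B can be cut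
-- down to the subalgebra generated by the image of A, so no generality is lost.

_∈𝔑𝔯CAω : ∀ {n} → RawCylindricAlgebra (Fin n) 0ℓ (lsuc 0ℓ) → Set (lsuc (lsuc 0ℓ))
_∈𝔑𝔯CAω {n} A = Σ[ B ∈ CylindricAlgebra ℕ 0ℓ (lsuc 0ℓ) ] (A ≅ 𝔑𝔯 n B)

-- Relational signatures with equality, as usual in algebraic logic.

record Signature : Set₁ where
  field
    Rel   : Set
    arity : Rel → ℕ

Countable : Signature → Set
Countable S = Signature.Rel S ↣ ℕ

record Structure (S : Signature) : Set₁ where
  open Signature S
  field
    Dom       : Set
    inhabited : Dom
    ⟦_⟧       : (R : Rel) → Vec Dom (arity R) → Set

module _ (S : Signature) (n : ℕ) where
  open Signature S

  infix  9 _≐_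
  infix  8 ¬̇_
  infixr 7 _∧̇_
  infixr 6 _∨̇_

  data Formula : Set where
    rel     : (R : Rel) → Vec (Fin n) (arity R) → Formula
    _≐_     : Fin n → Fin n → Formula
    ⊤̇ ⊥̇     : Formula
    ¬̇_      : Formula → Formula
    _∧̇_ _∨̇_ : Formula → Formula → Formula
    ∃̇       : Fin n → Formula → Formula

module _ {S : Signature} {n : ℕ} where
  open Signature S
  open Structure

  infixr 5 _⇒̇_
  infix  5 _⇔̇_

  _⇒̇_ _⇔̇_ : Formula S n → Formula S n → Formula S n
  φ ⇒̇ ψ = (¬̇ φ) ∨̇ ψ
  φ ⇔̇ ψ = (φ ⇒̇ ψ) ∧̇ (ψ ⇒̇ φ)

  _FreeIn_ : Fin n → Formula S n → Set
  i FreeIn rel R v  = i Vec.∈ v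
  i FreeIn (j ≐ k)  = i ≡ j ⊎ i ≡ k
  i FreeIn ⊤̇        = ⊥
  i FreeIn ⊥̇        = ⊥
  i FreeIn (¬̇ φ)    = i FreeIn φ
  i FreeIn (φ ∧̇ ψ)  = i FreeIn φ ⊎ i FreeIn ψ
  i FreeIn (φ ∨̇ ψ)  = i FreeIn φ ⊎ i FreeIn ψ
  i FreeIn (∃̇ j φ)  = i ≢ j × i FreeIn φ

  Sentence : Formula S n → Set
  Sentence φ = ∀ i → ¬ (i FreeIn φ)

  -- An assignment s ∈ ⁿM is a vector of length n.

  infix 3 _,_⊩_

  _,_⊩_ : (M : Structure S) → Vec (Dom M) n → Formula S n → Set
  M , s ⊩ rel R v = ⟦ M ⟧ R (map (lookup s) v)
  M , s ⊩ i ≐ j   = lookup s i ≡ lookup s j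
  M , s ⊩ ⊤̇       = ⊤
  M , s ⊩ ⊥̇       = ⊥
  M , s ⊩ ¬̇ φ     = ¬ (M , s ⊩ φ)
  M , s ⊩ φ ∧̇ ψ   = (M , s ⊩ φ) × (M , s ⊩ ψ)
  M , s ⊩ φ ∨̇ ψ   = (M , s ⊩ φ) ⊎ (M , s ⊩ ψ)
  M , s ⊩ ∃̇ i φ   = ∃[ a ] (M , s [ i ]≔ a ⊩ φ)

  _Omits_ : Structure S → Pred (Formula S n) 0ℓ → Set
  M Omits Γ = ¬ (∃[ s ] (∀ φ → φ ∈ Γ → M , s ⊩ φ))

record Theory (S : Signature) (n : ℕ) : Set₁ where
  field
    Axiom    : Pred (Formula S n) 0ℓ
    sentence : ∀ φ → φ ∈ Axiom → Sentence φ

module _ {S : Signature} {n : ℕ} where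

  _IsModelOf_ : Structure S → Theory S n → Set
  M IsModelOf T = ∀ φ → φ ∈ Theory.Axiom T → ∀ s → M , s ⊩ φ

  infix 3 _⊨_

  _⊨_ : Theory S n → Formula S n → Set₁
  T ⊨ φ = ∀ (M : Structure S) → M IsModelOf T → ∀ s → M , s ⊩ φ

  -- Consistency is semantic: no provability relation is introduced, and by
  -- completeness a consistent set of formulas is a satisfiable one.

  Consistent : Theory S n → Set₁
  Consistent T = ¬ (T ⊨ ⊥̇)

  _ConsistentWith_ : Formula S n → Theory S n → Set₁
  ψ ConsistentWith T = ¬ (T ⊨ ¬̇ ψ)

  NonPrincipal : Theory S n → Pred (Formula S n) 0ℓ → Set₁
  NonPrincipal T Γ = ¬ (∃[ ψ ] (ψ ConsistentWith T × (∀ φ → φ ∈ Γ → T ⊨ ψ ⇒̇ φ)))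

  -- The Tarski–Lindenbaum algebra: the quotient by T-equivalence is the
  -- setoid equality of the algebra.

  𝔉𝔪 : Theory S n → RawCylindricAlgebra (Fin n) 0ℓ (lsuc 0ℓ)
  𝔉𝔪 T = record
    { Carrier = Formula S n
    ; _≈_     = λ φ ψ → T ⊨ φ ⇔̇ ψ
    ; _+_     = _∨̇_
    ; _·_     = _∧̇_
    ; -_      = ¬̇_
    ; 𝟏       = ⊤̇
    ; 𝟎       = ⊥̇
    ; c       = ∃̇
    ; d       = _≐_
    }

-- Families are indexed by K and may repeat types.  Over a countable
-- signature every theory is countable.

OTT : Set → Set (lsuc (lsuc 0ℓ))
OTT K =
  ∀ (n : ℕ) → 2 ℕ.< n →
  ∀ (S : Signature) → Countable S →
  ∀ (T : Theory S n) → Consistent T → 𝔉𝔪 T ∈𝔑𝔯CAω →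
  ∀ (Γ : K → Pred (Formula S n) 0ℓ) → (∀ k → NonPrincipal T (Γ k)) →
  Σ[ M ∈ Structure S ] (M IsModelOf T × (∀ k → M Omits Γ k))

{-# OPTIONS --safe #-}
module Submission where

-- Let T say, in a language of countably many propositional letters, that the
-- domain has exactly one element.  A model of T amounts to a point of 2^ω, and
-- signed binary expansion Σ ±2^-(i+1) maps 2^ω to ℝ so that every cylinder has
-- dense image in an interval.  For a nowhere dense A ⊆ ℝ, the formulas true at
-- every point mapped into A form a type; it is non-principal, since below every
-- cylinder lies another whose image misses A.  A model realises the type of each
-- A containing its real number, so over a cover of ℝ not all types are omitted.

open import Defs
open import Algebra.Lattice.Structures using (IsBooleanAlgebra)
open import Axiom.ExcludedMiddle using (ExcludedMiddle)
open import Data.Bool.Base using (Bool; T; true; false; not; _∧_; _∨_; if_then_else_)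
import Data.Bool.Properties as Bool
open import Data.Empty using (⊥-elim)
open import Data.Fin.Base using (zero; suc)
import Data.Integer.Base as ℤ
open import Data.Integer.Solver using () renaming (module +-*-Solver to ℤ-Solver)
open import Data.Nat.Base as ℕ using (ℕ; zero; suc; z≤n; s≤s)
import Data.Nat.Properties as ℕ
open import Data.Product.Base using (∃-syntax; _×_; _,_; proj₁; proj₂)
open import Data.Rational.Base as ℚ using (ℚ; mkℚ; 0ℚ; _+_; _-_; -_; ∣_∣; _≤_; _<_)
import Data.Rational.Properties as ℚ
open import Data.Rational.Solver using () renaming (module +-*-Solver to ℚ-Solver)
open import Data.Rational.Unnormalised.Base as ℚᵘ using (mkℚᵘ; *≡*; *<*)
import Data.Rational.Unnormalised.Properties as ℚᵘ
open import Data.Sum.Base using (inj₁; inj₂)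
open import Data.Unit.Base using (⊤; tt)
open import Data.Vec.Base using ([]; replicate; _[_]≔_)
open import Function.Base using (id)
open import Function.Construct.Identity using (↣-id)
open import Level using (lift; lower; 0ℓ) renaming (suc to lsuc)
open import Relation.Binary.PropositionalEquality
  using (_≡_; refl; sym; trans; cong; cong₂; subst; subst₂)
open import Relation.Nullary.Decidable using (yes; no; does; proof; dec-true; dec-false; map′)
open import Relation.Nullary.Negation using (¬_; contradiction)
open import Relation.Nullary.Reflects
  using (Reflects; ofʸ; ofⁿ; invert; det; ¬-reflects; _×-reflects_; _⊎-reflects_; T-reflects)
open import Relation.Unary using (Pred; _∈_; _⊆_)

p≤p+q : ∀ p {q} → 0ℚ < q → p ≤ p + q
p≤p+q p {q} 0<q = subst (_≤ p + q) (ℚ.+-identityʳ p) (ℚ.+-monoʳ-≤ p (ℚ.<⇒≤ 0<q))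

∣p∣≤r : ∀ {p r} → p ≤ r → - p ≤ r → ∣ p ∣ ≤ r
∣p∣≤r {p} p≤r -p≤r with ℚ.∣p∣≡p∨∣p∣≡-p p
... | inj₁ eq = subst (_≤ _) (sym eq) p≤r
... | inj₂ eq = subst (_≤ _) (sym eq) -p≤r

dist-sym : ∀ p q → ∣ p - q ∣ ≡ ∣ q - p ∣
dist-sym p q = trans (sym (ℚ.∣-p∣≡∣p∣ (p - q))) (cong ∣_∣ (solve 2 (λ p q → :- (p :- q) := q :- p) refl p q))
  where open ℚ-Solver

dist-trans : ∀ p q r {s t} → ∣ p - q ∣ ≤ s → ∣ q - r ∣ ≤ t → ∣ p - r ∣ ≤ s + t
dist-trans p q r pq qr = ℚ.≤-trans
  (subst (λ x → ∣ x ∣ ≤ ∣ p - q ∣ + ∣ q - r ∣)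
    (solve 3 (λ p q r → (p :- q) :+ (q :- r) := p :- r) refl p q r)
    (ℚ.∣p+q∣≤∣p∣+∣q∣ (p - q) (q - r)))
  (ℚ.+-mono-≤ pq qr)
  where open ℚ-Solver

pred2^ : ℕ → ℕ
pred2^ zero    = 0
pred2^ (suc k) = suc (pred2^ k ℕ.+ pred2^ k)

k≤pred2^k : ∀ k → k ℕ.≤ pred2^ k
k≤pred2^k zero    = z≤n
k≤pred2^k (suc k) = s≤s (ℕ.≤-trans (k≤pred2^k k) (ℕ.m≤m+n _ _))

-- Unfolding 2^-_ makes unification compute normal forms of rationals.
abstract
  2^-_ : ℕ → ℚ
  2^- k = ℚ.fromℚᵘ (mkℚᵘ (ℤ.+ 1) (pred2^ k))

  2^-suc+2^-suc : ∀ k → 2^- suc k + 2^- suc k ≡ 2^- k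
  2^-suc+2^-suc k = ℚ.toℚᵘ-injective (begin
    ℚ.toℚᵘ (2^- suc k + 2^- suc k)              ≈⟨ ℚ.toℚᵘ-homo-+ (2^- suc k) (2^- suc k) ⟩
    ℚ.toℚᵘ (2^- suc k) ℚᵘ.+ ℚ.toℚᵘ (2^- suc k)  ≈⟨ ℚᵘ.+-cong (ℚ.toℚᵘ-fromℚᵘ h′) (ℚ.toℚᵘ-fromℚᵘ h′) ⟩
    h′ ℚᵘ.+ h′                                  ≈⟨ *≡* (doubling (ℤ.+ pred2^ k)) ⟩
    h                                           ≈⟨ ℚ.toℚᵘ-fromℚᵘ h ⟨
    ℚ.toℚᵘ (2^- k)                              ∎)
    where
    open ℚᵘ.≃-Reasoning
    h h′ : ℚᵘ.ℚᵘ
    h  = mkℚᵘ (ℤ.+ 1) (pred2^ k)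
    h′ = mkℚᵘ (ℤ.+ 1) (pred2^ (suc k))
    open ℤ-Solver
    doubling : ∀ x → let y = ℤ.1ℤ ℤ.+ (ℤ.1ℤ ℤ.+ (x ℤ.+ x)) in
      (ℤ.1ℤ ℤ.* y ℤ.+ ℤ.1ℤ ℤ.* y) ℤ.* (ℤ.1ℤ ℤ.+ x) ≡ ℤ.1ℤ ℤ.* (y ℤ.* y)
    doubling = solve 1 (λ x → let o = con ℤ.1ℤ; y = o :+ (o :+ (x :+ x)) in
      (o :* y :+ o :* y) :* (o :+ x) := o :* (y :* y)) refl

  0<2^- : ∀ k → 0ℚ < 2^- k
  0<2^- k = ℚ.toℚᵘ-cancel-< (ℚᵘ.<-respʳ-≃ (ℚᵘ.≃-sym (ℚ.toℚᵘ-fromℚᵘ (mkℚᵘ (ℤ.+ 1) (pred2^ k))))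
    (*<* (ℤ.+<+ (s≤s z≤n))))

  2^-archimedean : ∀ ε → 0ℚ < ε → ∃[ k ] 2^- k < ε
  2^-archimedean (mkℚ (ℤ.+ zero)  d _) (ℚ.*<* (ℤ.+<+ ()))
  2^-archimedean (mkℚ (ℤ.+ suc n) d c) _ = suc d , ℚ.toℚᵘ-cancel-<
    (ℚᵘ.<-respˡ-≃ (ℚᵘ.≃-sym (ℚ.toℚᵘ-fromℚᵘ (mkℚᵘ (ℤ.+ 1) (pred2^ (suc d)))))
      (*<* (ℤ.+<+ (ℕ.≤-trans (s≤s (subst (ℕ._≤ pred2^ (suc d)) (cong suc (sym (ℕ.+-identityʳ d))) (k≤pred2^k (suc d))))
        (ℕ.m≤m+n _ (n ℕ.* suc (pred2^ (suc d))))))))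
  2^-archimedean (mkℚ (ℤ.-[1+ n ]) d _) (ℚ.*<* ())

2^-antitone : ∀ d k → 2^- (d ℕ.+ k) ≤ 2^- k
2^-antitone zero    k = ℚ.≤-refl
2^-antitone (suc d) k = ℚ.≤-trans
  (subst (2^- suc (d ℕ.+ k) ≤_) (2^-suc+2^-suc (d ℕ.+ k))
    (p≤p+q (2^- suc (d ℕ.+ k)) (0<2^- (suc (d ℕ.+ k)))))
  (2^-antitone d k)

±_ : Bool → ℚ → ℚ
(± true)  p = p
(± false) p = - p

∣±p∣≤p : ∀ b {p} → 0ℚ ≤ p → ∣ (± b) p ∣ ≤ p
∣±p∣≤p true  0≤p = ℚ.≤-reflexive (ℚ.0≤p⇒∣p∣≡p 0≤p)
∣±p∣≤p false 0≤p = ℚ.≤-reflexive (trans (ℚ.∣-p∣≡∣p∣ _) (ℚ.0≤p⇒∣p∣≡p 0≤p))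

step-towards : ∀ p {h} → ∣ p ∣ ≤ h + h → ∃[ b ] ∣ p - (± b) h ∣ ≤ h
step-towards p {h} ∣p∣≤2h with ℚ.≤-total 0ℚ p
... | inj₁ 0≤p = true , ∣p∣≤r
  (subst (p - h ≤_) (solve 1 (λ h → (h :+ h) :- h := h) refl h)
    (ℚ.+-monoˡ-≤ (- h) (subst (_≤ h + h) (ℚ.0≤p⇒∣p∣≡p 0≤p) ∣p∣≤2h)))
  (subst₂ _≤_ (solve 2 (λ p h → h :+ :- p := :- (p :- h)) refl p h) (ℚ.+-identityʳ h)
    (ℚ.+-monoʳ-≤ h (ℚ.neg-antimono-≤ 0≤p)))
  where open ℚ-Solver
... | inj₂ p≤0 = false , ∣p∣≤r
  (subst₂ _≤_ (solve 2 (λ p h → h :+ p := p :- (:- h)) refl p h) (ℚ.+-identityʳ h)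
    (ℚ.+-monoʳ-≤ h p≤0))
  (subst₂ _≤_ (solve 2 (λ p h → :- p :- h := :- (p :- (:- h))) refl p h)
    (solve 1 (λ h → (h :+ h) :- h := h) refl h)
    (ℚ.+-monoˡ-≤ (- h)
      (subst (_≤ h + h) (trans (sym (ℚ.∣-p∣≡∣p∣ p)) (ℚ.0≤p⇒∣p∣≡p (ℚ.neg-antimono-≤ p≤0))) ∣p∣≤2h)))
  where open ℚ-Solver

Valuation : Set
Valuation = ℕ → Bool

Agree : ℕ → Valuation → Valuation → Set
Agree k v w = ∀ i → i ℕ.< k → v i ≡ w i

_[_↦_] : Valuation → ℕ → Bool → Valuation
(v [ k ↦ b ]) i = if does (i ℕ.≟ k) then b else v i

update-here : ∀ v k b → (v [ k ↦ b ]) k ≡ b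
update-here v k b = cong (if_then b else v k) (dec-true (k ℕ.≟ k) refl)

update-below : ∀ v k b → Agree k v (v [ k ↦ b ])
update-below v k b i i<k = sym (cong (if_then b else v i) (dec-false (i ℕ.≟ k) (ℕ.<⇒≢ i<k)))

partial : Valuation → ℕ → ℚ
partial v zero    = 0ℚ
partial v (suc k) = partial v k + (± v k) (2^- suc k)

partial-cong : ∀ k {v w} → Agree k v w → partial v k ≡ partial w k
partial-cong zero    _  = refl
partial-cong (suc k) vw = cong₂ (λ p b → p + (± b) (2^- suc k))
  (partial-cong k (λ i i<k → vw i (ℕ.m<n⇒m<1+n i<k))) (vw k (ℕ.n<1+n k))

-- The error term on the left makes the induction close.
partial-tail : ∀ v d m → ∣ partial v m - partial v (d ℕ.+ m) ∣ + 2^- (d ℕ.+ m) ≤ 2^- m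
partial-tail v zero m = ℚ.≤-reflexive (trans
  (cong (λ p → ∣ p ∣ + 2^- m) (ℚ.+-inverseʳ (partial v m))) (ℚ.+-identityˡ (2^- m)))
partial-tail v (suc d) m = begin
  ∣ s - (s′ + x) ∣ + h        ≤⟨ ℚ.+-monoˡ-≤ h (dist-trans s s′ (s′ + x) ℚ.≤-refl x≤h) ⟩
  (∣ s - s′ ∣ + h) + h        ≡⟨ ℚ.+-assoc ∣ s - s′ ∣ h h ⟩
  ∣ s - s′ ∣ + (h + h)        ≡⟨ cong (∣ s - s′ ∣ +_) (2^-suc+2^-suc (d ℕ.+ m)) ⟩
  ∣ s - s′ ∣ + 2^- (d ℕ.+ m)  ≤⟨ partial-tail v d m ⟩
  2^- m                       ∎
  where
  open ℚ.≤-Reasoning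
  s s′ h x : ℚ
  s  = partial v m
  s′ = partial v (d ℕ.+ m)
  h  = 2^- suc (d ℕ.+ m)
  x  = (± v (d ℕ.+ m)) h
  open ℚ-Solver
  x≤h : ∣ s′ - (s′ + x) ∣ ≤ h
  x≤h = subst (_≤ h)
    (trans (sym (ℚ.∣-p∣≡∣p∣ x)) (cong ∣_∣ (solve 2 (λ s x → :- x := s :- (s :+ x)) refl s′ x)))
    (∣±p∣≤p (v (d ℕ.+ m)) (ℚ.<⇒≤ (0<2^- (suc (d ℕ.+ m)))))

partial-near : ∀ v {m n} → m ℕ.≤ n → ∣ partial v m - partial v n ∣ ≤ 2^- m
partial-near v {m} {n} m≤n = subst (λ k → ∣ partial v m - partial v k ∣ ≤ 2^- m) (ℕ.m∸n+n≡m m≤n)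
  (ℚ.≤-trans (p≤p+q ∣ partial v m - partial v (d ℕ.+ m) ∣ (0<2^- (d ℕ.+ m))) (partial-tail v d m))
  where
  d : ℕ
  d = n ℕ.∸ m

real : Valuation → ℝ
real v = record { seq = partial v ; cauchy = cauchy }
  where
  cauchy : ∀ ε → 0ℚ < ε →
           ∃[ N ] (∀ m n → N ℕ.≤ m → N ℕ.≤ n → ∣ partial v m - partial v n ∣ < ε)
  cauchy ε 0<ε with 2^-archimedean ε 0<ε
  ... | k , 2^-k<ε = suc k , λ m n k<m k<n → ℚ.≤-<-trans
    (dist-trans (partial v m) (partial v (suc k)) (partial v n)
      (subst (_≤ 2^- suc k) (dist-sym (partial v (suc k)) (partial v m)) (partial-near v k<m))
      (partial-near v k<n))
    (subst (_< ε) (sym (2^-suc+2^-suc k)) 2^-k<ε)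

constant : ℚ → ℝ
constant q = record
  { seq    = λ _ → q
  ; cauchy = λ ε 0<ε → 0 , λ _ _ _ _ → subst (λ p → ∣ p ∣ < ε) (sym (ℚ.+-inverseʳ q)) 0<ε
  }

-- Greedy signed binary expansion, starting from the first m digits of v.
expand : ∀ v m q → ∣ q - partial v m ∣ ≤ 2^- m → ∀ d →
         ∃[ w ] (Agree m v w × ∣ q - partial w (m ℕ.+ d) ∣ ≤ 2^- (m ℕ.+ d))
expand v m q near zero =
  v , (λ _ _ → refl) , subst (λ k → ∣ q - partial v k ∣ ≤ 2^- k) (sym (ℕ.+-identityʳ m)) near
expand v m q near (suc d) =
  let k               = m ℕ.+ d
      w , vw , near-w = expand v m q near d
      b , near-b      = step-towards (q - partial w k)
                          (subst (∣ q - partial w k ∣ ≤_) (sym (2^-suc+2^-suc k)) near-w)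
      eq : (q - partial w k) - (± b) (2^- suc k) ≡ q - partial (w [ k ↦ b ]) (suc k)
      eq = trans (solve 3 (λ q p x → (q :- p) :- x := q :- (p :+ x)) refl q (partial w k) ((± b) (2^- suc k)))
             (cong₂ (λ p c → q - (p + (± c) (2^- suc k)))
               (partial-cong k (update-below w k b)) (sym (update-here w k b)))
  in w [ k ↦ b ] ,
     (λ i i<m → trans (vw i i<m) (update-below w k b i (ℕ.<-≤-trans i<m (ℕ.m≤m+n m d)))) ,
     subst (λ j → ∣ q - partial (w [ k ↦ b ]) j ∣ ≤ 2^- j) (sym (ℕ.+-suc m d))
       (subst (λ p → ∣ p ∣ ≤ 2^- suc k) eq near-b)
  where open ℚ-Solver

quarter : ∀ ε → 0ℚ < ε → ∃[ η ] (0ℚ < η × (η + (η + η)) < ε)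
quarter ε 0<ε with 2^-archimedean ε 0<ε
... | k , 2^-k<ε = η , 0<2^- (suc (suc k)) , ℚ.<-trans 3η<4η (subst (_< ε) (sym 4η) 2^-k<ε)
  where
  η : ℚ
  η = 2^- suc (suc k)
  4η : (η + η) + (η + η) ≡ 2^- k
  4η = trans (cong₂ _+_ (2^-suc+2^-suc (suc k)) (2^-suc+2^-suc (suc k))) (2^-suc+2^-suc k)
  3η<4η : η + (η + η) < (η + η) + (η + η)
  3η<4η = ℚ.+-monoˡ-< (η + η) (subst (_< η + η) (ℚ.+-identityʳ η) (ℚ.+-monoʳ-< η (0<2^- (suc (suc k)))))

cylinder-dense : ∀ v m (A : Pred ℝ 0ℓ) →
  (∀ w k → Agree m v w → ∃[ u ] (Agree k w u × real u ∈ A)) →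
  Ball (constant (partial v m)) (2^- m) ⊆ Closure A
cylinder-dense v m A meets {y} (δ , δ<h , N , near) ε 0<ε =
  let η , 0<η , 3η<ε = quarter ε 0<ε
      N′ , cauchy    = ℝ.cauchy y η 0<η
      d , 2^-d<η     = 2^-archimedean η 0<η
      k              = m ℕ.+ d
      l              = N ℕ.⊔ N′
      q              = ℝ.seq y l
      2^-k≤η         = ℚ.≤-trans (2^-antitone m d) (ℚ.<⇒≤ 2^-d<η)
      q-near         = subst (_≤ 2^- m) (dist-sym (partial v m) q)
                         (ℚ.≤-trans (near l (ℕ.m≤m⊔n N N′)) (ℚ.<⇒≤ δ<h))
      w , vw , qw    = expand v m q q-near d
      u , wu , u∈A   = meets w k vw
  in real u ,
     (η + (η + η) , 3η<ε , l ℕ.⊔ k , λ i l⊔k≤i →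
       dist-trans (ℝ.seq y i) q (partial u i)
         (ℚ.<⇒≤ (cauchy i l (ℕ.≤-trans (ℕ.m≤n⊔m N N′) (ℕ.m⊔n≤o⇒m≤o l k l⊔k≤i)) (ℕ.m≤n⊔m N N′)))
         (dist-trans q (partial u k) (partial u i)
           (subst (λ p → ∣ q - p ∣ ≤ η) (partial-cong k wu) (ℚ.≤-trans qw 2^-k≤η))
           (ℚ.≤-trans (partial-near u (ℕ.m⊔n≤o⇒n≤o l k l⊔k≤i)) 2^-k≤η))) ,
     u∈A

propositional : Signature
propositional = record { Rel = ℕ ; arity = λ _ → 0 }

eval : ∀ {n} → Valuation → Formula propositional n → Bool
eval v (rel R _) = v R
eval v (_ ≐ _)   = true
eval v ⊤̇         = true
eval v ⊥̇         = false
eval v (¬̇ φ)     = not (eval v φ)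
eval v (φ ∧̇ ψ)   = eval v φ ∧ eval v ψ
eval v (φ ∨̇ ψ)   = eval v φ ∨ eval v ψ
eval v (∃̇ _ φ)   = eval v φ

vars : ∀ {n} → Formula propositional n → ℕ
vars (rel R _) = suc R
vars (_ ≐ _)   = 0
vars ⊤̇         = 0
vars ⊥̇         = 0
vars (¬̇ φ)     = vars φ
vars (φ ∧̇ ψ)   = vars φ ℕ.⊔ vars ψ
vars (φ ∨̇ ψ)   = vars φ ℕ.⊔ vars ψ
vars (∃̇ _ φ)   = vars φ

Agree-≤ : ∀ {k l v w} → k ℕ.≤ l → Agree l v w → Agree k v w
Agree-≤ k≤l vw i i<k = vw i (ℕ.<-≤-trans i<k k≤l)

eval-cong : ∀ {n} (φ : Formula propositional n) {v w} → Agree (vars φ) v w → eval v φ ≡ eval w φ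
eval-cong (rel R _) vw = vw R (ℕ.n<1+n R)
eval-cong (_ ≐ _)   vw = refl
eval-cong ⊤̇         vw = refl
eval-cong ⊥̇         vw = refl
eval-cong (¬̇ φ)     vw = cong not (eval-cong φ vw)
eval-cong (φ ∧̇ ψ)   vw = cong₂ _∧_ (eval-cong φ (Agree-≤ (ℕ.m≤m⊔n (vars φ) (vars ψ)) vw))
                                   (eval-cong ψ (Agree-≤ (ℕ.m≤n⊔m (vars φ) (vars ψ)) vw))
eval-cong (φ ∨̇ ψ)   vw = cong₂ _∨_ (eval-cong φ (Agree-≤ (ℕ.m≤m⊔n (vars φ) (vars ψ)) vw))
                                   (eval-cong ψ (Agree-≤ (ℕ.m≤n⊔m (vars φ) (vars ψ)) vw))
eval-cong (∃̇ _ φ)   vw = eval-cong φ vw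

literal : ∀ {n} → ℕ → Bool → Formula propositional n
literal k true  = rel k []
literal k false = ¬̇ rel k []

cylinder : ∀ {n} → Valuation → ℕ → Formula propositional n
cylinder v zero    = ⊤̇
cylinder v (suc k) = cylinder v k ∧̇ literal k (v k)

eval-cylinder : ∀ {n} v k → eval v (cylinder {n} v k) ≡ true
eval-cylinder v zero = refl
eval-cylinder {n} v (suc k) = cong₂ _∧_ (eval-cylinder {n} v k) (eval-literal (v k) refl)
  where
  eval-literal : ∀ b → v k ≡ b → eval v (literal {n} k b) ≡ true
  eval-literal true  eq = eq
  eval-literal false eq = cong not eq

cylinder⇒Agree : ∀ {n} v k {w} → eval w (cylinder {n} v k) ≡ true → Agree k v w
cylinder⇒Agree {n} v (suc k) {w} eq i i<1+k with eval w (cylinder {n} v k) in eqᶜ | ℕ.m<1+n⇒m<n∨m≡n i<1+k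
... | true | inj₁ i<k  = cylinder⇒Agree v k eqᶜ i i<k
... | true | inj₂ refl = from-literal (v k) eq
  where
  from-literal : ∀ b → eval w (literal {n} k b) ≡ true → b ≡ w k
  from-literal true  eq = sym eq
  from-literal false eq = sym (Bool.not-injective eq)

one-element : ∀ {n} → Theory propositional (suc (suc n))
one-element = record
  { Axiom    = λ φ → φ ≡ ¬̇ ∃̇ zero (∃̇ (suc zero) (¬̇ (zero ≐ suc zero)))
  ; sentence = λ { _ refl i (i≢0 , i≢1 , inj₁ i≡0) → i≢0 i≡0
                 ; _ refl i (i≢0 , i≢1 , inj₂ i≡1) → i≢1 i≡1 }
  }

point : Valuation → Structure propositional
point v = record { Dom = ⊤ ; inhabited = tt ; ⟦_⟧ = λ R _ → T (v R) }

point-model : ∀ {n} v → point v IsModelOf one-element {n}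
point-model v _ refl s (_ , _ , 0≢1) = 0≢1 refl

∃-reflects : ∀ {A : Set} {P : A → Set} {b} → A → (∀ a → Reflects (P a) b) → Reflects (∃[ a ] P a) b
∃-reflects {b = true}  a r = ofʸ (a , invert (r a))
∃-reflects {b = false} _ r = ofⁿ (λ { (a , p) → invert (r a) p })

eval-reflects : ∀ {n} M v → (∀ (a b : Structure.Dom M) → a ≡ b) →
  (∀ R → Reflects (Structure.⟦_⟧ M R []) (v R)) →
  ∀ s (φ : Formula propositional n) → Reflects (M , s ⊩ φ) (eval v φ)
eval-reflects M v sub r s (rel R []) = r R
eval-reflects M v sub r s (i ≐ j)    = ofʸ (sub _ _)
eval-reflects M v sub r s ⊤̇          = ofʸ tt
eval-reflects M v sub r s ⊥̇          = ofⁿ id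
eval-reflects M v sub r s (¬̇ φ)      = ¬-reflects (eval-reflects M v sub r s φ)
eval-reflects M v sub r s (φ ∧̇ ψ)    = eval-reflects M v sub r s φ ×-reflects eval-reflects M v sub r s ψ
eval-reflects M v sub r s (φ ∨̇ ψ)    = eval-reflects M v sub r s φ ⊎-reflects eval-reflects M v sub r s ψ
eval-reflects M v sub r s (∃̇ i φ)    =
  ∃-reflects (Structure.inhabited M) (λ a → eval-reflects M v sub r (s [ i ]≔ a) φ)

⊨⇒eval : ∀ {n} (φ : Formula propositional (suc (suc n))) → one-element ⊨ φ → ∀ v → eval v φ ≡ true
⊨⇒eval φ ⊨φ v = det
  (eval-reflects (point v) v (λ _ _ → refl) (λ R → T-reflects (v R)) s φ)
  (ofʸ (⊨φ (point v) (point-model v) s))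
  where
  s = replicate _ tt

⇔⇒eval : ∀ {n} (φ ψ : Formula propositional (suc (suc n))) →
  one-element ⊨ φ ⇔̇ ψ → ∀ v → eval v φ ≡ eval v ψ
⇔⇒eval φ ψ φ⇔ψ v = iff _ _ (⊨⇒eval (φ ⇔̇ ψ) φ⇔ψ v)
  where
  iff : ∀ a b → (not a ∨ b) ∧ (not b ∨ a) ≡ true → a ≡ b
  iff false false _ = refl
  iff true  true  _ = refl

infix 4 _≈ᵉ_

-- A record rather than a function type, so that φ and ψ can be inferred.
record _≈ᵉ_ {n : ℕ} (φ ψ : Formula propositional n) : Set₁ where
  constructor equivalent
  field
    pointwise : ∀ v → eval v φ ≡ eval v ψ

open _≈ᵉ_

≈ᵉ-isBooleanAlgebra : ∀ {n} → IsBooleanAlgebra (_≈ᵉ_ {n}) _∨̇_ _∧̇_ ¬̇_ ⊤̇ ⊥̇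
≈ᵉ-isBooleanAlgebra = record
  { isDistributiveLattice = record
    { isLattice = record
      { isEquivalence = record
        { refl  = equivalent (λ _ → refl)
        ; sym   = λ eq → equivalent (λ v → sym (pointwise eq v))
        ; trans = λ eq eq′ → equivalent
            (λ v → trans (pointwise eq v) (pointwise eq′ v))
        }
      ; ∨-comm = λ φ ψ → equivalent (λ v → Bool.∨-comm (eval v φ) (eval v ψ))
      ; ∨-assoc = λ φ ψ χ → equivalent (λ v → Bool.∨-assoc (eval v φ) (eval v ψ) (eval v χ))
      ; ∨-cong = λ eq eq′ → equivalent
          (λ v → cong₂ _∨_ (pointwise eq v) (pointwise eq′ v))
      ; ∧-comm = λ φ ψ → equivalent (λ v → Bool.∧-comm (eval v φ) (eval v ψ))
      ; ∧-assoc = λ φ ψ χ → equivalent (λ v → Bool.∧-assoc (eval v φ) (eval v ψ) (eval v χ))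
      ; ∧-cong = λ eq eq′ → equivalent
          (λ v → cong₂ _∧_ (pointwise eq v) (pointwise eq′ v))
      ; absorptive =
          (λ φ ψ → equivalent (λ v → Bool.∨-abs-∧ (eval v φ) (eval v ψ))) ,
          (λ φ ψ → equivalent (λ v → Bool.∧-abs-∨ (eval v φ) (eval v ψ)))
      }
    ; ∨-distrib-∧ =
        (λ φ ψ χ → equivalent (λ v → Bool.∨-distribˡ-∧ (eval v φ) (eval v ψ) (eval v χ))) ,
        (λ φ ψ χ → equivalent (λ v → Bool.∨-distribʳ-∧ (eval v φ) (eval v ψ) (eval v χ)))
    ; ∧-distrib-∨ =
        (λ φ ψ χ → equivalent (λ v → Bool.∧-distribˡ-∨ (eval v φ) (eval v ψ) (eval v χ))) ,
        (λ φ ψ χ → equivalent (λ v → Bool.∧-distribʳ-∨ (eval v φ) (eval v ψ) (eval v χ)))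
    }
  ; ∨-complement =
      (λ φ → equivalent (λ v → Bool.∨-inverseˡ (eval v φ))) ,
      (λ φ → equivalent (λ v → Bool.∨-inverseʳ (eval v φ)))
  ; ∧-complement =
      (λ φ → equivalent (λ v → Bool.∧-inverseˡ (eval v φ))) ,
      (λ φ → equivalent (λ v → Bool.∧-inverseʳ (eval v φ)))
  ; ¬-cong = λ eq → equivalent (λ v → cong not (pointwise eq v))
  }

-- Quantifiers are vacuous and equations hold in one-element models, so the
-- Tarski–Lindenbaum algebra is itself a CA_ω with identity cylindrifications.
discrete : ℕ → CylindricAlgebra ℕ 0ℓ (lsuc 0ℓ)
discrete n = record
  { raw = record
    { Carrier = Formula propositional n
    ; _≈_ = _≈ᵉ_
    ; _+_ = _∨̇_
    ; _·_ = _∧̇_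
    ; -_  = ¬̇_
    ; 𝟏   = ⊤̇
    ; 𝟎   = ⊥̇
    ; c   = λ _ φ → φ
    ; d   = λ _ _ → ⊤̇
    }
  ; isCylindricAlgebra = record
    { isBooleanAlgebra = ≈ᵉ-isBooleanAlgebra
    ; c-cong = λ _ eq → eq
    ; c-zero = λ _ → equivalent (λ _ → refl)
    ; c-incr = λ _ φ → equivalent (λ v → Bool.∧-idem (eval v φ))
    ; c-meet = λ _ φ ψ → equivalent (λ v → refl)
    ; c-comm = λ _ _ φ → equivalent (λ v → refl)
    ; d-refl = λ _ → equivalent (λ _ → refl)
    ; d-comp = λ _ _ _ _ _ → equivalent (λ _ → refl)
    ; d-func = λ _ _ φ _ → equivalent (λ v → Bool.∧-inverseʳ (eval v φ))
    }
  }

membership-type : ∀ {n} → Pred ℝ 0ℓ → Pred (Formula propositional n) 0ℓ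
membership-type A φ = ∀ v → real v ∈ A → eval v φ ≡ true

module _ (em : ExcludedMiddle 0ℓ) where

  valuation : Structure propositional → Valuation
  valuation M R = does (em {Structure.⟦_⟧ M R []})

  model-reflects : ∀ {n} M → M IsModelOf one-element {n} →
    ∀ s (φ : Formula propositional (suc (suc n))) → Reflects (M , s ⊩ φ) (eval (valuation M) φ)
  model-reflects M M⊨T = eval-reflects M (valuation M) subsingleton (λ R → proof em)
    where
    open Structure M
    subsingleton : ∀ a b → a ≡ b
    subsingleton a b with em {a ≡ b}
    ... | yes a≡b = a≡b
    ... | no a≢b  = ⊥-elim (M⊨T _ refl (replicate _ inhabited) (a , b , a≢b))

  eval⇒⊩ : ∀ {n} M → M IsModelOf one-element {n} →
    ∀ s (φ : Formula propositional (suc (suc n))) → eval (valuation M) φ ≡ true → M , s ⊩ φ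
  eval⇒⊩ M M⊨T s φ eq = invert (subst (Reflects _) eq (model-reflects M M⊨T s φ))

  eval⇒⇔ : ∀ {n} (φ ψ : Formula propositional (suc (suc n))) →
    (∀ v → eval v φ ≡ eval v ψ) → one-element ⊨ φ ⇔̇ ψ
  eval⇒⇔ φ ψ eq M M⊨T s = eval⇒⊩ M M⊨T s (φ ⇔̇ ψ) (iff (eq (valuation M)))
    where
    iff : ∀ {a b} → a ≡ b → (not a ∨ b) ∧ (not b ∨ a) ≡ true
    iff {false} refl = refl
    iff {true}  refl = refl

  𝔉𝔪-neat : ∀ {n} → 𝔉𝔪 (one-element {n}) ∈𝔑𝔯CAω
  𝔉𝔪-neat {n} = discrete (suc (suc n)) , record
    { to        = λ φ → φ , λ _ _ → equivalent (λ _ → refl)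
    ; cong      = λ {φ} {ψ} φ⇔ψ → equivalent (⇔⇒eval φ ψ φ⇔ψ)
    ; bijective = (λ {φ} {ψ} eq → eval⇒⇔ φ ψ (pointwise eq)) ,
                  λ (ψ , _) → ψ , λ {φ} φ⇔ψ → equivalent (⇔⇒eval φ ψ φ⇔ψ)
    ; +-homo    = λ _ _ → equivalent (λ _ → refl)
    ; ·-homo    = λ _ _ → equivalent (λ _ → refl)
    ; neg-homo  = λ _ → equivalent (λ _ → refl)
    ; 𝟏-homo    = equivalent (λ _ → refl)
    ; 𝟎-homo    = equivalent (λ _ → refl)
    ; c-homo    = λ _ _ → equivalent (λ _ → refl)
    ; d-homo    = λ _ _ → equivalent (λ _ → refl)
    }

  membership-type-nonPrincipal : ∀ {n} {A : Pred ℝ 0ℓ} → NowhereDense A →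
    NonPrincipal (one-element {n}) (membership-type A)
  membership-type-nonPrincipal {A = A} nowhere-dense (ψ , consistent , isolates) = consistent refuted
    where
    true-nowhere : ∀ v → ¬ (eval v ψ ≡ true)
    true-nowhere v ψ-true = nowhere-dense (constant (partial v m))
      (2^- m , 0<2^- m , λ {y} → cylinder-dense v m A meets {y})
      where
      m : ℕ
      m = vars ψ
      meets : ∀ w k → Agree m v w → ∃[ u ] (Agree k w u × real u ∈ A)
      meets w k vw with em {∃[ u ] (Agree k w u × real u ∈ A)}
      ... | yes met   = met
      ... | no missed = contradiction
        (trans (sym w-fails) (⊨⇒eval (ψ ⇒̇ ¬̇ cylinder w k) (isolates (¬̇ cylinder w k) in-type) w)) λ ()
        where
        in-type : ∀ u → real u ∈ A → eval u (¬̇ cylinder w k) ≡ true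
        in-type u u∈A = cong not (Bool.¬-not λ eq → missed (u , cylinder⇒Agree w k eq , u∈A))
        w-fails : eval w (ψ ⇒̇ ¬̇ cylinder w k) ≡ false
        w-fails = cong₂ (λ a b → not a ∨ not b)
          (trans (sym (eval-cong ψ vw)) ψ-true) (eval-cylinder w k)

    refuted : one-element ⊨ ¬̇ ψ
    refuted M M⊨T s = eval⇒⊩ M M⊨T s (¬̇ ψ) (cong not (Bool.¬-not (true-nowhere (valuation M))))

theorem5p18 : ExcludedMiddle (lsuc 0ℓ) → (K : Set) → IsCovK K → ¬ OTT K
theorem5p18 em K ((A , _ , nowhere-dense , covers) , _) ott =
  omits k (s , λ φ φ∈Γ → eval⇒⊩ em₀ M M⊨T s φ (φ∈Γ v v∈A))
  where
  em₀ : ExcludedMiddle 0ℓ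
  em₀ = map′ lower lift em

  omitting = ott 3 (s≤s (s≤s (s≤s z≤n))) propositional (↣-id ℕ)
    one-element (λ ⊨⊥ → ⊨⊥ (point (λ _ → true)) (point-model _) (replicate 3 tt)) (𝔉𝔪-neat em₀)
    (λ k → membership-type (A k)) (λ k → membership-type-nonPrincipal em₀ (nowhere-dense k))

  M     = proj₁ omitting
  M⊨T   = proj₁ (proj₂ omitting)
  omits = proj₂ (proj₂ omitting)
  s     = replicate 3 (Structure.inhabited M)
  v     = valuation em₀ M
  k     = proj₁ (covers (real v))
  v∈A   = proj₂ (covers (real v))
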